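{- Let $G$ be a (not necessarily connected) graph of order $n\ge 2$ and let $\overline G$ be its complement. Then $3\le\lambda(G)+\lambda(\overline G)\le 2n-1$. Moreover: (i) $\lambda(G)+\lambda(\overline G)=3$ if and only if $\{G,\overline G\}=\{K_2,\overline K_2\}$; (ii) $\lambda(G)+\lambda(\overline G)=2n-1$ if and only if $\{G,\overline G\}=\{K_n,\overline K_n\}$. (Equalities of graphs are up to isomorphism.)
   Context: Graphs are finite, simple and undirected, and not necessarily connected; a graph is nontrivial if it has order $n\ge 2$. $K_n$ is the complete graph and $\overline K_n$ the edgeless graph on $n$ vertices. For a graph $G=(V,E)$, $N(v)$ is the open neighborhood of $v$. A set $D\subseteq V$ is a locating-dominating set (LD-set) if $N(u)\cap D\neq\emptyset$ for every $u\in V\setminus D$ and $N(u)\cap D\ne N(v)\cap D$ for every two distinct vertices $u,v\in V\setminus D$. The location-domination number $\lambda(G)$ is the minimum cardinality of a locating-dominating set of $G$. -}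

module Defs where

open import Data.Empty using (⊥)
open import Data.Fin using (Fin; _≟_)
open import Data.Fin.Properties using (all?)
open import Data.Fin.Subset using (Subset; _∈_; _∉_; _∩_; ∣_∣; Nonempty; ⊤)
open import Data.Fin.Subset.Properties using (_∈?_; nonempty?; anySubset?; ∈⊤)
open import Data.Bool.Properties using () renaming (_≟_ to _≟ᵇ_)
open import Data.Nat using (ℕ; _≤_; _<_; _<?_)
open import Data.Nat.Induction using (<-wellFounded)
open import Data.Nat.Properties using (≮⇒≥)
open import Data.Product using (Σ; ∃; _×_; _,_; proj₁; proj₂)
open import Data.Vec using (tabulate)
open import Data.Vec.Properties using (≡-dec)
open import Function using (_∘_; _⇔_; _↔_; Inverse)
open import Induction.WellFounded using (Acc; acc)
open import Level using (0ℓ)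
open import Relation.Binary using (Rel; Irreflexive; Symmetric; Decidable)
open import Relation.Binary.PropositionalEquality using (_≡_; _≢_; refl; sym)
open import Relation.Nullary using (¬_; Dec; yes; no; does; contradiction)
open import Relation.Nullary.Decidable using (¬?; _×-dec_; _→-dec_)
open import Relation.Unary using (Pred; _∪_)

record Graph (n : ℕ) : Set₁ where
  field
    Adj    : Rel (Fin n) 0ℓ
    adj?   : Decidable Adj
    irrefl : Irreflexive _≡_ Adj
    symm   : Symmetric Adj

open Graph public

complement : ∀ {n} → Graph n → Graph n
complement G = record
  { Adj    = λ u v → u ≢ v × ¬ Adj G u v
  ; adj?   = λ u v → ¬? (u ≟ v) ×-dec ¬? (adj? G u v)
  ; irrefl = λ { refl (u≢u , _) → u≢u refl }
  ; symm   = λ { (u≢v , ¬uv) → u≢v ∘ sym , ¬uv ∘ symm G }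
  }

K : (n : ℕ) → Graph n
K n = record
  { Adj    = _≢_
  ; adj?   = λ u v → ¬? (u ≟ v)
  ; irrefl = λ { refl u≢u → u≢u refl }
  ; symm   = λ u≢v → u≢v ∘ sym
  }

edgeless : (n : ℕ) → Graph n
edgeless n = record
  { Adj    = λ _ _ → ⊥
  ; adj?   = λ _ _ → no λ ()
  ; irrefl = λ _ ()
  ; symm   = λ ()
  }

infix 4 _≅_

_≅_ : ∀ {m n} → Graph m → Graph n → Set
_≅_ {m} {n} G H = Σ (Fin m ↔ Fin n) λ f →
  ∀ u v → Adj G u v ⇔ Adj H (Inverse.to f u) (Inverse.to f v)

-- The set {G, H} with graphs taken up to isomorphism, as the predicate of being
-- isomorphic to one of its members. Graphs of every order are in its domain.
｛_,_｝ : ∀ {m n} → Graph m → Graph n → Pred (∃ Graph) 0ℓ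
｛ G , H ｝ = (λ X → proj₂ X ≅ G) ∪ (λ X → proj₂ X ≅ H)

N : ∀ {n} → Graph n → Fin n → Subset n
N G v = tabulate λ u → does (adj? G v u)

LocatingDominating : ∀ {n} → Graph n → Subset n → Set
LocatingDominating G D =
  (∀ u → u ∉ D → Nonempty (N G u ∩ D)) ×
  (∀ u v → u ∉ D → v ∉ D → u ≢ v → N G u ∩ D ≢ N G v ∩ D)

IsLDNumber : ∀ {n} → Graph n → ℕ → Set
IsLDNumber G k =
  (∃ λ D → LocatingDominating G D × ∣ D ∣ ≡ k) ×
  (∀ D → LocatingDominating G D → k ≤ ∣ D ∣)

locatingDominating? : ∀ {n} (G : Graph n) (D : Subset n) → Dec (LocatingDominating G D)
locatingDominating? G D =
  all? (λ u → ¬? (u ∈? D) →-dec nonempty? (N G u ∩ D))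
  ×-dec
  all? (λ u → all? λ v →
    ¬? (u ∈? D) →-dec ¬? (v ∈? D) →-dec ¬? (u ≟ v) →-dec
    ¬? (≡-dec _≟ᵇ_ (N G u ∩ D) (N G v ∩ D)))

ldNumber-exists : ∀ {n} (G : Graph n) → ∃ (IsLDNumber G)
ldNumber-exists G = descend ⊤ ⊤-isLD (<-wellFounded _)
  where
  ⊤-isLD : LocatingDominating G ⊤
  ⊤-isLD = (λ u u∉⊤ → contradiction ∈⊤ u∉⊤) , (λ u v u∉⊤ → contradiction ∈⊤ u∉⊤)

  descend : ∀ D → LocatingDominating G D → Acc _<_ ∣ D ∣ → ∃ (IsLDNumber G)
  descend D ld (acc rs)
    with anySubset? (λ D′ → locatingDominating? G D′ ×-dec (∣ D′ ∣ <? ∣ D ∣))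
  ... | yes (D′ , ld′ , D′<D) = descend D′ ld′ (rs D′<D)
  ... | no ∄smaller =
    ∣ D ∣ , (D , ld , refl) , λ D′ ld′ → ≮⇒≥ λ D′<D → ∄smaller (D′ , ld′ , D′<D)

ldNumber : ∀ {n} → Graph n → ℕ
ldNumber = proj₁ ∘ ldNumber-exists

ldNumber-isLDNumber : ∀ {n} (G : Graph n) → IsLDNumber G (ldNumber G)
ldNumber-isLDNumber = proj₂ ∘ ldNumber-exists

{-# OPTIONS --safe #-}
-- λ(G) = n forces G to be edgeless, because removing an endpoint of any edge from V
-- leaves an LD-set; one of G and its complement has an edge, which gives the upper
-- bound and its equality case. In the other direction, at most one vertex outside an
-- LD-set D sees all of D. If G is complete this gives λ(G) ≥ n − 1, and if |D| = 1 it
-- gives n ≤ 2, so for n ≥ 3 both numbers are at least 2; every graph of order 2 is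
-- complete or edgeless.
module Submission where

open import Defs
open import Data.Empty using (⊥-elim)
open import Data.Fin using (Fin; zero; suc; _≟_)
open import Data.Fin.Permutation using (↔⇒≡)
open import Data.Fin.Properties using (any?)
open import Data.Fin.Subset using (Subset; _∈_; _∉_; _∩_; _⊆_; ∣_∣; Nonempty; ⊤; ⁅_⁆; ∁)
open import Data.Fin.Subset.Properties
open import Data.Nat using (ℕ; _+_; _*_; _∸_; _≤_; _<_; s≤s)
open import Data.Nat.Properties hiding (_≟_)
open import Data.Product using (_×_; _,_; proj₁; proj₂; ∃₂)
open import Data.Sum using (_⊎_; inj₁; inj₂; [_,_]; map; swap)
open import Data.Vec.Properties using (lookup∘tabulate; []=⇒lookup; lookup⇒[]=)
open import Function using (_∘_; _⇔_; Equivalence; Inverse; mk⇔)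
open import Function.Construct.Composition using (_⇔-∘_)
open import Function.Construct.Identity using (⇔-id; ↔-id)
open import Function.Construct.Symmetry using (⇔-sym)
open import Relation.Binary.PropositionalEquality
  using (_≡_; _≢_; refl; sym; trans; cong; subst)
open import Relation.Nullary using (¬_; yes; no; contradiction)
open import Relation.Nullary.Decidable using (dec-true; dec-false; decidable-stable)
open import Relation.Unary using (_≐_)

private
  variable
    n : ℕ

-- Cardinalities of subsets

x∈p⇒⁅x⁆⊆p : ∀ {x : Fin n} {p} → x ∈ p → ⁅ x ⁆ ⊆ p
x∈p⇒⁅x⁆⊆p {x = x} {p} x∈p y∈⁅x⁆ = subst (_∈ p) (sym (x∈⁅y⁆⇒x≡y x y∈⁅x⁆)) x∈p

-- A second element would make `⁅ x ⁆` a proper subset of `p`.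
∣p∣≤1⇒unique : {p : Subset n} → ∣ p ∣ ≤ 1 → ∀ {x y} → x ∈ p → y ∈ p → y ≡ x
∣p∣≤1⇒unique {p = p} ∣p∣≤1 {x} {y} x∈p y∈p = decidable-stable (y ≟ x) λ y≢x →
  <⇒≱ (p⊂q⇒∣p∣<∣q∣ (x∈p⇒⁅x⁆⊆p x∈p , y , y∈p , y≢x ∘ x∈⁅y⁆⇒x≡y x))
      (subst (∣ p ∣ ≤_) (sym (∣⁅x⁆∣≡1 x)) ∣p∣≤1)

∀∈⇒∣p∣≥n : {p : Subset n} → (∀ x → x ∈ p) → n ≤ ∣ p ∣
∀∈⇒∣p∣≥n {n} {p} all∈ = subst (_≤ ∣ p ∣) (∣⊤∣≡n n)
  (p⊆q⇒∣p∣≤∣q∣ {p = ⊤} λ {x} _ → all∈ x)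

∣∁⁅x⁆∣≡n∸1 : (x : Fin n) → ∣ ∁ ⁅ x ⁆ ∣ ≡ n ∸ 1
∣∁⁅x⁆∣≡n∸1 {n} x = trans (∣∁p∣≡n∸∣p∣ ⁅ x ⁆) (cong (n ∸_) (∣⁅x⁆∣≡1 x))

unique∉⇒∣p∣≥n∸1 : {p : Subset n} → (∀ x y → x ∉ p → y ∉ p → x ≡ y) → n ∸ 1 ≤ ∣ p ∣
unique∉⇒∣p∣≥n∸1 {n} {p} unique with nonempty? (∁ p)
-- If `p` misses some `x`, it misses nothing else and so contains `∁ ⁅ x ⁆`; otherwise `p` is
-- everything.
... | yes (x , x∈∁p) = subst (_≤ ∣ p ∣) (∣∁⁅x⁆∣≡n∸1 x) (p⊆q⇒∣p∣≤∣q∣ λ {y} y∈∁⁅x⁆ →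
  decidable-stable (y ∈? p) λ y∉p → x∈∁p⇒x∉p y∈∁⁅x⁆
    (subst (_∈ ⁅ x ⁆) (unique x y (x∈∁p⇒x∉p x∈∁p) y∉p) (x∈⁅x⁆ x)))
... | no ∁p-empty = ≤-trans (m∸n≤m n 1) (∀∈⇒∣p∣≥n λ x →
  decidable-stable (x ∈? p) λ x∉p → ∁p-empty (x , x∉p⇒x∈∁p x∉p))

∈N⁺ : (G : Graph n) → ∀ {u v} → Adj G u v → v ∈ N G u
∈N⁺ G {u} {v} uv =
  lookup⇒[]= v _ (trans (lookup∘tabulate _ v) (dec-true (adj? G u v) uv))

∈N⁻ : (G : Graph n) → ∀ {u v} → v ∈ N G u → Adj G u v
∈N⁻ G {u} {v} v∈N = decidable-stable (adj? G u v) λ ¬uv → contradiction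
  (trans (sym (dec-false (adj? G u v) ¬uv))
    (trans (sym (lookup∘tabulate _ v)) ([]=⇒lookup v∈N)))
  λ ()

-- Complete and edgeless graphs, described by adjacency

Complete Edgeless Extreme : Graph n → Set
Complete G = ∀ u v → u ≢ v → Adj G u v
Edgeless G = ∀ u v → ¬ Adj G u v
Extreme G = Complete G ⊎ Complete (complement G)

complete⇒complement-edgeless : (G : Graph n) → Complete G → Edgeless (complement G)
complete⇒complement-edgeless G complete u v (u≢v , ¬uv) = ¬uv (complete u v u≢v)

complement-complete⇒edgeless : (G : Graph n) → Complete (complement G) → Edgeless G
complement-complete⇒edgeless G complete u v uv = proj₂ (complete u v u≢v) uv
  where
  u≢v : u ≢ v
  u≢v u≡v = irrefl G u≡v uv

edgeless⇒complement-complete : (G : Graph n) → Edgeless G → Complete (complement G)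
edgeless⇒complement-complete G edgeless u v u≢v = u≢v , edgeless u v

complement-edgeless⇒complete : (G : Graph n) → Edgeless (complement G) → Complete G
complement-edgeless⇒complete G edgeless u v u≢v =
  decidable-stable (adj? G u v) λ ¬uv → edgeless u v (u≢v , ¬uv)

edgeless⊎edge : (G : Graph n) → Edgeless G ⊎ ∃₂ (Adj G)
edgeless⊎edge G with any? (λ u → any? (adj? G u))
... | yes edge = inj₂ edge
... | no ∄edge = inj₁ λ u v uv → ∄edge (u , v , uv)

-- The vertices 0 and 1 are distinct, hence adjacent in the graph or in its complement.
edge⊎complement-edge : 2 ≤ n → (G : Graph n) → ∃₂ (Adj G) ⊎ ∃₂ (Adj (complement G))
edge⊎complement-edge (s≤s (s≤s _)) G with adj? G zero (suc zero)
... | yes 01∈E = inj₁ (_ , _ , 01∈E)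
... | no  01∉E = inj₂ (_ , _ , (λ ()) , 01∉E)

order2⇒extreme : (G : Graph 2) → Extreme G
order2⇒extreme G with adj? G zero (suc zero)
... | yes 01∈E = inj₁ λ
  { zero       zero       0≢0 → contradiction refl 0≢0
  ; zero       (suc zero) _   → 01∈E
  ; (suc zero) zero       _   → symm G 01∈E
  ; (suc zero) (suc zero) 1≢1 → contradiction refl 1≢1
  }
... | no 01∉E = inj₂ λ
  { zero       zero       0≢0 → contradiction refl 0≢0
  ; zero       (suc zero) 0≢1 → 0≢1 , 01∉E
  ; (suc zero) zero       1≢0 → 1≢0 , 01∉E ∘ symm G
  ; (suc zero) (suc zero) 1≢1 → contradiction refl 1≢1
  }

-- Bounds on the location-domination number

ldNumber-≤ : (G : Graph n) → ∀ D → LocatingDominating G D → ldNumber G ≤ ∣ D ∣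
ldNumber-≤ G = proj₂ (ldNumber-isLDNumber G)

ldNumber-≥ : (G : Graph n) → ∀ {k} →
  (∀ D → LocatingDominating G D → k ≤ ∣ D ∣) → k ≤ ldNumber G
ldNumber-≥ G bound with ldNumber-isLDNumber G
... | (D , ld , ∣D∣≡λ) , _ = ≤-trans (bound D ld) (≤-reflexive ∣D∣≡λ)

-- The witness is `∁ ⁅ u ⁆`: its only outside vertex `u` is dominated by `v`, and no two distinct
-- vertices are left to separate.
edge⇒ldNumber≤n∸1 : (G : Graph n) → ∃₂ (Adj G) → ldNumber G ≤ n ∸ 1
edge⇒ldNumber≤n∸1 {n} G (u , v , uv) = ≤-trans
  (ldNumber-≤ G (∁ ⁅ u ⁆) (dominating , locating)) (≤-reflexive (∣∁⁅x⁆∣≡n∸1 u))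
  where
  only-u : ∀ w → w ∉ ∁ ⁅ u ⁆ → w ≡ u
  only-u w w∉ = x∈⁅y⁆⇒x≡y u (x∉∁p⇒x∈p w∉)

  v∈D : v ∈ ∁ ⁅ u ⁆
  v∈D = x∉p⇒x∈∁p λ v∈⁅u⁆ → irrefl G (sym (x∈⁅y⁆⇒x≡y u v∈⁅u⁆)) uv

  dominating : ∀ w → w ∉ ∁ ⁅ u ⁆ → Nonempty (N G w ∩ ∁ ⁅ u ⁆)
  dominating w w∉ rewrite only-u w w∉ = v , x∈p∩q⁺ (∈N⁺ G uv , v∈D)

  locating : ∀ x y → x ∉ ∁ ⁅ u ⁆ → y ∉ ∁ ⁅ u ⁆ → x ≢ y →
    N G x ∩ ∁ ⁅ u ⁆ ≢ N G y ∩ ∁ ⁅ u ⁆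
  locating x y x∉ y∉ x≢y _ = x≢y (trans (only-u x x∉) (sym (only-u y y∉)))

ldNumber≤n : (G : Graph n) → ldNumber G ≤ n
ldNumber≤n G with ldNumber-isLDNumber G
... | (D , _ , ∣D∣≡λ) , _ = subst (_≤ _) ∣D∣≡λ (∣p∣≤n D)

-- A vertex outside `D` would need a neighbor in `D`, so `D` omits nothing.
edgeless⇒ldNumber≥n : (G : Graph n) → Edgeless G → n ≤ ldNumber G
edgeless⇒ldNumber≥n G edgeless = ldNumber-≥ G λ D (dominating , _) →
  ∀∈⇒∣p∣≥n λ u → decidable-stable (u ∈? D) λ u∉D →
    let v , v∈N∩D = dominating u u∉D
    in edgeless u v (∈N⁻ G (p∩q⊆p (N G u) D v∈N∩D))

-- A vertex outside D that sees all of D has D as its trace, so locating leaves only one.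
⊆N⇒∣D∣≥n∸1 : (G : Graph n) → ∀ D → LocatingDominating G D →
  (∀ u → u ∉ D → D ⊆ N G u) → n ∸ 1 ≤ ∣ D ∣
⊆N⇒∣D∣≥n∸1 G D (_ , locating) D⊆N = unique∉⇒∣p∣≥n∸1 λ u v u∉D v∉D →
  decidable-stable (u ≟ v) λ u≢v →
    locating u v u∉D v∉D u≢v (trans (trace u u∉D) (sym (trace v v∉D)))
  where
  trace : ∀ u → u ∉ D → N G u ∩ D ≡ D
  trace u u∉D = ⊆-antisym (p∩q⊆q (N G u) D) λ w∈D → x∈p∩q⁺ (D⊆N u u∉D w∈D , w∈D)

complete⇒ldNumber≥n∸1 : (G : Graph n) → Complete G → n ∸ 1 ≤ ldNumber G
complete⇒ldNumber≥n∸1 G complete = ldNumber-≥ G λ D ld →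
  ⊆N⇒∣D∣≥n∸1 G D ld λ u u∉D {v} v∈D →
    ∈N⁺ G (complete u v λ u≡v → u∉D (subst (_∈ D) (sym u≡v) v∈D))

-- If `D` has at most one element, the neighbor that dominates an outside vertex is all of `D`.
-- Hence every outside vertex sees all of `D`, and n - 1 ≤ 1.
2<n⇒ldNumber≥2 : 2 < n → (G : Graph n) → 2 ≤ ldNumber G
2<n⇒ldNumber≥2 (s≤s 2≤n∸1) G = ldNumber-≥ G λ D ld → ≰⇒> λ ∣D∣≤1 →
  <⇒≱ 2≤n∸1 (≤-trans (⊆N⇒∣D∣≥n∸1 G D ld λ u u∉D {v} v∈D →
    let w , w∈N∩D = proj₁ ld u u∉D
        w∈N , w∈D = x∈p∩q⁻ (N G u) D w∈N∩D
    in subst (_∈ N G u) (∣p∣≤1⇒unique ∣D∣≤1 v∈D w∈D) w∈N)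
    ∣D∣≤1)

-- Splits the bound into the shares of the two graphs, so that monotonicity of addition applies.
2n∸1≡n+[n∸1] : 2 ≤ n → 2 * n ∸ 1 ≡ n + (n ∸ 1)
2n∸1≡n+[n∸1] {n} 2≤n rewrite +-identityʳ n = +-∸-assoc n (<⇒≤ 2≤n)

-- The sum for a graph and its complement

ldSum : Graph n → ℕ
ldSum G = ldNumber G + ldNumber (complement G)

ldSum≤2n∸1 : 2 ≤ n → (G : Graph n) → ldSum G ≤ 2 * n ∸ 1
ldSum≤2n∸1 {n} 2≤n G = ≤-trans bound (≤-reflexive (sym (2n∸1≡n+[n∸1] 2≤n)))
  where
  bound : ldSum G ≤ n + (n ∸ 1)
  -- Whichever graph has the edge contributes at most n - 1, the other at most n.
  bound = [ (λ edge → ≤-trans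
              (+-mono-≤ (edge⇒ldNumber≤n∸1 G edge) (ldNumber≤n (complement G)))
              (≤-reflexive (+-comm (n ∸ 1) n)))
          , (λ edge → +-mono-≤ (ldNumber≤n G) (edge⇒ldNumber≤n∸1 (complement G) edge))
          ] (edge⊎complement-edge 2≤n G)

ldSum≡2n∸1⇒extreme : 2 ≤ n → (G : Graph n) → ldSum G ≡ 2 * n ∸ 1 → Extreme G
ldSum≡2n∸1⇒extreme {n} 2≤n@(s≤s _) G sum≡
  with edgeless⊎edge G | edgeless⊎edge (complement G)
... | inj₁ edgeless | _              = inj₂ (edgeless⇒complement-complete G edgeless)
... | inj₂ _        | inj₁ edgeless = inj₁ (complement-edgeless⇒complete G edgeless)
-- Two edges bound the sum by 2(n - 1). As n is matched as a successor, `s≤s` turns λ(G) ≤ n - 1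
-- into λ(G) < n.
... | inj₂ edge     | inj₂ edge′    = contradiction (trans sum≡ (2n∸1≡n+[n∸1] 2≤n))
  (<⇒≢ (+-mono-≤ (s≤s (edge⇒ldNumber≤n∸1 G edge))
                 (edge⇒ldNumber≤n∸1 (complement G) edge′)))

extreme⇒ldSum≥2n∸1 : 2 ≤ n → (G : Graph n) → Extreme G → 2 * n ∸ 1 ≤ ldSum G
extreme⇒ldSum≥2n∸1 {n} 2≤n G extreme =
  ≤-trans (≤-reflexive (2n∸1≡n+[n∸1] 2≤n)) (bound extreme)
  where
  bound : Extreme G → n + (n ∸ 1) ≤ ldSum G
  bound (inj₁ complete) = ≤-trans (≤-reflexive (+-comm n (n ∸ 1)))
    (+-mono-≤ (complete⇒ldNumber≥n∸1 G complete)
      (edgeless⇒ldNumber≥n (complement G) (complete⇒complement-edgeless G complete)))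
  bound (inj₂ complete) =
    +-mono-≤ (edgeless⇒ldNumber≥n G (complement-complete⇒edgeless G complete))
      (complete⇒ldNumber≥n∸1 (complement G) complete)

extreme⇒ldSum≡2n∸1 : 2 ≤ n → (G : Graph n) → Extreme G → ldSum G ≡ 2 * n ∸ 1
extreme⇒ldSum≡2n∸1 2≤n G extreme =
  ≤-antisym (ldSum≤2n∸1 2≤n G) (extreme⇒ldSum≥2n∸1 2≤n G extreme)

2<n⇒ldSum>3 : 2 < n → (G : Graph n) → 3 < ldSum G
2<n⇒ldSum>3 2<n G = +-mono-≤ (2<n⇒ldNumber≥2 2<n G) (2<n⇒ldNumber≥2 2<n (complement G))

-- Pairs of graphs up to isomorphism

≅-respʳ-Adj : {m : ℕ} (X : Graph m) (G H : Graph n) →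
  (∀ u v → Adj G u v ⇔ Adj H u v) → X ≅ G → X ≅ H
≅-respʳ-Adj X G H G⇔H (f , X⇔G) = f , λ u v → G⇔H _ _ ⇔-∘ X⇔G u v

complete⇔K : (G : Graph n) → Complete G → ∀ u v → Adj G u v ⇔ Adj (K n) u v
complete⇔K G complete u v = mk⇔ (λ uv u≡v → irrefl G u≡v uv) (complete u v)

edgeless⇔edgeless : (G : Graph n) → Edgeless G → ∀ u v → Adj G u v ⇔ Adj (edgeless n) u v
edgeless⇔edgeless G ∄edge u v = mk⇔ (∄edge u v) ⊥-elim

｛｝-cong : (G G′ H H′ : Graph n) → (∀ u v → Adj G u v ⇔ Adj G′ u v) →
  (∀ u v → Adj H u v ⇔ Adj H′ u v) → ｛ G , H ｝ ≐ ｛ G′ , H′ ｝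
｛｝-cong G G′ H H′ G⇔G′ H⇔H′ =
  (λ {(_ , X)} → map (≅-respʳ-Adj X G G′ G⇔G′) (≅-respʳ-Adj X H H′ H⇔H′)) ,
  (λ {(_ , X)} → map (≅-respʳ-Adj X G′ G λ u v → ⇔-sym (G⇔G′ u v))
                     (≅-respʳ-Adj X H′ H λ u v → ⇔-sym (H⇔H′ u v)))

extreme⇒≐ : (G : Graph n) → Extreme G → ｛ G , complement G ｝ ≐ ｛ K n , edgeless n ｝
extreme⇒≐ {n} G (inj₁ complete) = ｛｝-cong G (K n) (complement G) (edgeless n)
  (complete⇔K G complete)
  (edgeless⇔edgeless (complement G) (complete⇒complement-edgeless G complete))
-- Here the complement matches `K n`, so the two members trade places.
extreme⇒≐ {n} G (inj₂ complete) =
  (λ {X} → proj₁ swapped {X} ∘ swap) , (λ {X} → swap ∘ proj₂ swapped {X})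
  where
  swapped : ｛ complement G , G ｝ ≐ ｛ K n , edgeless n ｝
  swapped = ｛｝-cong (complement G) (K n) G (edgeless n)
    (complete⇔K (complement G) complete)
    (edgeless⇔edgeless G (complement-complete⇒edgeless G complete))

K≅⇒complete : (G : Graph n) → K n ≅ G → Complete G
K≅⇒complete G (f , K⇔G) u v u≢v =
  -- `u` and `v` are the images of their preimages, which are distinct and so adjacent in `K n`.
  subst (λ w → Adj G w v) (strictlyInverseˡ u)
    (subst (Adj G _) (strictlyInverseˡ v)
      (Equivalence.to (K⇔G (from u) (from v)) λ eq → u≢v
        (trans (sym (strictlyInverseˡ u)) (trans (cong to eq) (strictlyInverseˡ v)))))
  where open Inverse f

-- `K m` belongs to the right-hand set by the identity; testing the equality of sets on it yields an
-- actual isomorphism.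
K-member : ∀ {m} {G H : Graph n} → ｛ G , H ｝ ≐ ｛ K m , edgeless m ｝ → K m ≅ G ⊎ K m ≅ H
K-member {m = m} (_ , ⊇) = ⊇ {m , K m} (inj₁ (↔-id _ , λ _ _ → ⇔-id _))

≐⇒extreme : (G : Graph n) → ｛ G , complement G ｝ ≐ ｛ K n , edgeless n ｝ → Extreme G
≐⇒extreme {n} G eq with K-member {G = G} {complement G} eq
... | inj₁ K≅G = inj₁ (K≅⇒complete G K≅G)
... | inj₂ K≅Ḡ = inj₂ (K≅⇒complete (complement G) K≅Ḡ)

≐⇒order≡ : ∀ {m} (G : Graph n) → ｛ G , complement G ｝ ≐ ｛ K m , edgeless m ｝ → m ≡ n
≐⇒order≡ G eq = [ ↔⇒≡ ∘ proj₁ , ↔⇒≡ ∘ proj₁ ] (K-member {G = G} {complement G} eq)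

-- The lower bound and the equality cases

ldSum≥3 : 2 ≤ n → (G : Graph n) → 3 ≤ ldSum G
ldSum≥3 2≤n G with m≤n⇒m<n∨m≡n 2≤n
... | inj₁ 2<n  = <⇒≤ (2<n⇒ldSum>3 2<n G)
-- For n = 2 the value `2 * n ∸ 1` computes to 3.
... | inj₂ refl = extreme⇒ldSum≥2n∸1 2≤n G (order2⇒extreme G)

ldSum≡3⇒≐ : 2 ≤ n → (G : Graph n) → ldSum G ≡ 3 →
  ｛ G , complement G ｝ ≐ ｛ K 2 , edgeless 2 ｝
ldSum≡3⇒≐ 2≤n G sum≡3 with m≤n⇒m<n∨m≡n 2≤n
... | inj₁ 2<n  = contradiction (sym sum≡3) (<⇒≢ (2<n⇒ldSum>3 2<n G))
... | inj₂ refl = extreme⇒≐ G (order2⇒extreme G)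

≐⇒ldSum≡3 : 2 ≤ n → (G : Graph n) →
  ｛ G , complement G ｝ ≐ ｛ K 2 , edgeless 2 ｝ → ldSum G ≡ 3
-- The sets range over graphs of all orders, so n = 2 has to be read off a bijection of vertices.
≐⇒ldSum≡3 2≤n G eq with ≐⇒order≡ {m = 2} G eq
... | refl = extreme⇒ldSum≡2n∸1 2≤n G (order2⇒extreme G)

theorem5 : (n : ℕ) → 2 ≤ n → (G : Graph n) →
    (3 ≤ ldNumber G + ldNumber (complement G)) ×
    (ldNumber G + ldNumber (complement G) ≤ 2 * n ∸ 1) ×
    (ldNumber G + ldNumber (complement G) ≡ 3 ⇔
    ｛ G , complement G ｝ ≐ ｛ K 2 , edgeless 2 ｝) ×
    (ldNumber G + ldNumber (complement G) ≡ 2 * n ∸ 1 ⇔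
    ｛ G , complement G ｝ ≐ ｛ K n , edgeless n ｝)
theorem5 n 2≤n G =
  ldSum≥3 2≤n G ,
  ldSum≤2n∸1 2≤n G ,
  mk⇔ (ldSum≡3⇒≐ 2≤n G) (≐⇒ldSum≡3 2≤n G) ,
  mk⇔ (extreme⇒≐ G ∘ ldSum≡2n∸1⇒extreme 2≤n G)
      (extreme⇒ldSum≡2n∸1 2≤n G ∘ ≐⇒extreme G)
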